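{- Let $T=(V,E)$ be a tree with at least $5$ vertices and let $\{x_1,\dots,x_k\}\subseteq V$ be a set of $k$ (pairwise distinct) vertices of $T$, where $k$ is a strictly positive integer. Then $T$ is minimal for $\{x_1,\dots,x_k\}$ if and only if the following three assertions all hold: 1. For all $x\neq y$ in $\mathcal{L}(T)$, $dist(x,y)\ge 3$. 2. For each $x\in\mathcal{L}(T)$, $\{x,x^+\}\cap\{x_1,\dots,x_k\}\neq\emptyset$. 3. For each $i\in\{1,\dots,k\}$, if $x_i\in\mathcal{S}(T)$ and $x_i^-\notin\{x_1,\dots,x_k\}$, then $d(x_i)=2$ and there is $j\in\{1,\dots,k\}$, $j\neq i$, such that $x_j\in\mathcal{L}(T)$ and $dist(x_i,x_j)=2$.
   Context: Graphs are finite, simple and undirected. For a graph $G=(V,E)$, a module of $G$ is a subset $M\subseteq V$ such that every vertex outside $M$ is adjacent to all or to none of the vertices of $M$. The modules $\emptyset$, $\{x\}$ ($x\in V$) and $V$ are trivial. $G$ is prime if it has at least four vertices and all its modules are trivial. For a vertex subset $X$, a prime graph $G$ is minimal for $X$ if no proper induced subgraph of $G$ containing $X$ is prime. $d(x)$ is the degree of $x$; $dist(x,y)$ is the number of edges of a shortest path between $x$ and $y$. A leaf is a vertex of degree one; for a leaf $x$, $x^+$ denotes its unique neighbor, called a support vertex. $\mathcal{L}(T)$ and $\mathcal{S}(T)$ are the sets of leaves and of support vertices of $T$. If a support vertex $x$ has a unique leaf neighbor, that leaf is denoted $x^-$ (under assertion 1 every support vertex has a unique leaf neighbor). -}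

module Defs where

open import Data.Bool using (true; false)
open import Data.Fin using (Fin; zero; suc)
open import Data.Fin.Subset using (Subset; _∈_; _∉_; _⊂_; ⊥; ⊤; ⁅_⁆; ∣_∣)
open import Data.List using (List; []; _∷_)
open import Data.List.Relation.Unary.Unique.Propositional using (Unique)
open import Data.Nat using (ℕ; _≤_)
open import Data.Product using (Σ; ∃-syntax; _×_; _,_)
open import Data.Sum using (_⊎_)
open import Data.Vec using (tabulate; []; _∷_)
open import Level using (0ℓ)
open import Relation.Binary using (Rel; Decidable; Symmetric; Irreflexive)
open import Relation.Binary.Construct.Closure.ReflexiveTransitive using (Star; ε; _◅_)
open import Relation.Binary.PropositionalEquality using (_≡_)
open import Relation.Nullary using (¬_; does)
open import Relation.Unary using (Pred)

record Graph (n : ℕ) : Set₁ where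
  field
    _~_    : Rel (Fin n) 0ℓ
    _~?_   : Decidable _~_
    sym    : Symmetric _~_
    irrefl : Irreflexive _≡_ _~_

-- The elements of S listed in increasing order.
enum : ∀ {n} (S : Subset n) → Fin ∣ S ∣ → Fin n
enum (true  ∷ S) zero    = zero
enum (true  ∷ S) (suc i) = suc (enum S i)
enum (false ∷ S) i       = suc (enum S i)

-- The induced subgraph on S, with vertex i of G [ S ] standing for the
-- vertex enum S i of G.
_[_] : ∀ {n} → Graph n → (S : Subset n) → Graph ∣ S ∣
G [ S ] = record
  { _~_    = λ i j → enum S i ~ enum S j
  ; _~?_   = λ i j → enum S i ~? enum S j
  ; sym    = sym
  ; irrefl = λ { _≡_.refl → irrefl _≡_.refl }
  }
  where open Graph G

module _ {n : ℕ} (G : Graph n) where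
  open Graph G

  IsModule : Subset n → Set
  IsModule M = ∀ v → v ∉ M → (∀ u → u ∈ M → v ~ u) ⊎ (∀ u → u ∈ M → ¬ (v ~ u))

  Trivial : Subset n → Set
  Trivial M = M ≡ ⊥ ⊎ (∃[ x ] M ≡ ⁅ x ⁆) ⊎ M ≡ ⊤

  Prime : Set
  Prime = 4 ≤ n × (∀ M → IsModule M → Trivial M)

  neighbours : Fin n → Subset n
  neighbours v = tabulate (λ u → does (v ~? u))

  degree : Fin n → ℕ
  degree v = ∣ neighbours v ∣

  Walk : Rel (Fin n) 0ℓ
  Walk = Star _~_

  length : ∀ {u v} → Walk u v → ℕ
  length ε       = 0
  length (_ ◅ w) = ℕ.suc (length w)

  vertices : ∀ {u v} → Walk u v → List (Fin n)
  vertices {u} ε       = u ∷ []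
  vertices {u} (_ ◅ w) = u ∷ vertices w

  Path : Rel (Fin n) 0ℓ
  Path u v = Σ (Walk u v) (λ w → Unique (vertices w))

  pathLength : ∀ {u v} → Path u v → ℕ
  pathLength (w , _) = length w

  Connected : Set
  Connected = ∀ u v → Path u v

  -- A cycle is a path with at least two edges closed up by an edge joining its
  -- ends.
  Acyclic : Set
  Acyclic = ∀ {u v} (p : Path u v) → 2 ≤ pathLength p → ¬ (v ~ u)

  -- The order is not required to be positive here, so the empty graph counts
  -- as a tree.
  Tree : Set
  Tree = Connected × Acyclic

  -- Distance u v d means dist(u,v) = d; no d qualifies if u and v are not
  -- joined by a path.
  Distance : Fin n → Fin n → ℕ → Set
  Distance u v d = Σ (Path u v) (λ p → pathLength p ≡ d)
                 × (∀ (p : Path u v) → d ≤ pathLength p)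

  Leaf : Pred (Fin n) 0ℓ
  Leaf v = degree v ≡ 1

  -- IsPlus x y means y = x⁺.
  IsPlus : Rel (Fin n) 0ℓ
  IsPlus x y = Leaf x × x ~ y × (∀ z → x ~ z → z ≡ y)

  Support : Pred (Fin n) 0ℓ
  Support y = ∃[ x ] IsPlus x y

  -- IsMinus x y means that x⁻ is defined and y = x⁻: the support vertex x has
  -- y as its only leaf neighbour.
  IsMinus : Rel (Fin n) 0ℓ
  IsMinus x y = Leaf y × x ~ y × (∀ z → Leaf z → x ~ z → z ≡ y)

⟦_⟧ : ∀ {k n} → (Fin k → Fin n) → Pred (Fin n) 0ℓ
⟦ x ⟧ v = ∃[ i ] x i ≡ v

-- The proper induced subgraphs of G are the G [ S ] with S ⊂ ⊤.
Minimal : ∀ {n} → Graph n → Pred (Fin n) 0ℓ → Set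
Minimal G X = Prime G × (∀ S → (∀ v → X v → v ∈ S) → S ⊂ ⊤ → ¬ Prime (G [ S ]))

module _ {n k : ℕ} (T : Graph n) (x : Fin k → Fin n) where
  open Graph T

  Assertion₁ : Set
  Assertion₁ = ∀ u v → Leaf T u → Leaf T v → ¬ (u ≡ v) →
               ∃[ d ] (Distance T u v d × 3 ≤ d)

  Assertion₂ : Set
  Assertion₂ = ∀ u → Leaf T u → ∃[ v ] (IsPlus T u v × (⟦ x ⟧ u ⊎ ⟦ x ⟧ v))

  -- x⁻ is only guaranteed to exist under Assertion₁, hence the quantification
  -- over y: without a unique leaf neighbour nothing is claimed about x i.
  Assertion₃ : Set
  Assertion₃ = ∀ i → Support T (x i) → ∀ y → IsMinus T (x i) y → ¬ ⟦ x ⟧ y →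
               degree T (x i) ≡ 2 ×
               (∃[ j ] (¬ (j ≡ i) × Leaf T (x j) × Distance T (x i) (x j) 2))

{-# OPTIONS --safe #-}
module Submission where

-- A module of an induced subgraph of a tree with at least two elements is
-- either closed under adjacency or a set of pendant vertices at one common
-- neighbour, because trees have no triangles and no 4-cycles.  Hence a tree with
-- at least four vertices is prime iff no two leaves are twins, and deleting a
-- leaf u at v from a prime tree keeps it prime unless v has degree two and its
-- other neighbour y carries a leaf; in that case deleting both u and v works.
-- This yields assertions 2 and 3 from minimality.  Conversely, if S is a proper
-- subset inducing a prime subgraph, some leaf u lies outside S (otherwise the
-- branches at a vertex outside S are modules), and assertions 2 and 3 make
-- {x_i , x_j} a module of the subgraph on S.

open import Defs
open import Data.Bool using (true; false)
open import Data.Empty using (⊥-elim)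
open import Data.Fin using (Fin; zero; suc)
open import Data.Fin.Properties using (_≟_; any?; all?; suc-injective; injective⇒≤)
open import Data.Fin.Subset using (Subset; _∈_; _∉_; _⊆_; _⊂_; _∪_; ∁; ⊤; ⁅_⁆; ∣_∣)
open import Data.Fin.Subset.Properties
  using (_∈?_; ∈⊤; ∉⊥; ∣⊤∣≡n; x∈⁅x⁆; x∈⁅y⁆⇒x≡y; Empty-unique; ⊆-antisym; ∣⁅x⁆∣≡1; ∣∁p∣≡n∸∣p∣;
         x∈∁p⇒x∉p; x∉p⇒x∈∁p; x∈p∪q⁻; x∈p∪q⁺; x∈p∧x≢y⇒x∈p-y; x∈p⇒∣p-x∣<∣p∣)
open import Data.List using (List; []; _∷_)
import Data.List as List
import Data.List.Membership.DecPropositional as DecMembership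
open import Data.List.Membership.Propositional using () renaming (_∈_ to _∈ₗ_; _∉_ to _∉ₗ_)
open import Data.List.Membership.Setoid.Properties using (index-injective)
open import Data.List.Relation.Unary.All using (All; []; _∷_)
import Data.List.Relation.Unary.All as All
open import Data.List.Relation.Unary.All.Properties using (¬Any⇒All¬; All¬⇒¬Any)
open import Data.List.Relation.Unary.AllPairs using ([]; _∷_)
open import Data.List.Relation.Unary.Any using (here; there; index)
open import Data.List.Relation.Unary.Unique.Propositional using (Unique)
open import Data.Nat using (ℕ; zero; suc; _+_; _∸_; _≤_; _<_; z≤n; s≤s)
open import Data.Nat.Properties
  using (≤-trans; ≤-reflexive; ≤-antisym; <⇒≱; ∸-monoˡ-≤; +-suc; m<m+n; n≤1+n) renaming (_≟_ to _≟ℕ_)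
open import Data.Product using (Σ; ∃-syntax; _×_; _,_; proj₁; proj₂)
open import Data.Sum using (_⊎_; inj₁; inj₂; [_,_]′)
open import Data.Unit using (tt)
open import Data.Vec using (_∷_; here; there; tabulate)
open import Data.Vec.Properties using ([]=⇒lookup; lookup⇒[]=; lookup∘tabulate)
open import Function using (_∘_; id)
open import Function.Bundles using (_⇔_; mk⇔)
open import Function.Definitions using (Injective)
open import Level using (0ℓ)
open import Relation.Binary using (Rel)
open import Relation.Binary.Construct.Closure.ReflexiveTransitive using (Star; ε; _◅_; _◅◅_; reverse)
open import Relation.Binary.PropositionalEquality using (_≡_; _≢_; refl; sym; trans; cong; subst; setoid; ≢-sym)
open import Relation.Nullary using (¬_; Dec; yes; no; does; ¬?)
open import Relation.Nullary.Decidable using (dec-true; decidable-stable; _×-dec_; _⊎-dec_; _→-dec_)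
open import Relation.Unary using (Pred; Decidable; U)

-- Finite subsets: tabulation, enumeration and counting.

module _ {n : ℕ} where
  open DecMembership (_≟_ {n}) using () renaming (_∈?_ to _∈ₗ?_) public

module _ {n : ℕ} {P : Pred (Fin n) 0ℓ} (P? : Decidable P) where

  ∈-tabulate⁺ : ∀ {v} → P v → v ∈ tabulate (λ u → does (P? u))
  ∈-tabulate⁺ {v} pv = lookup⇒[]= v _ (trans (lookup∘tabulate _ v) (dec-true (P? v) pv))

  ∈-tabulate⁻ : ∀ {v} → v ∈ tabulate (λ u → does (P? u)) → P v
  ∈-tabulate⁻ {v} v∈ with P? v | trans (sym (lookup∘tabulate (λ u → does (P? u)) v)) ([]=⇒lookup v∈)
  ... | yes pv | _ = pv
  ... | no _   | ()

enum-∈ : ∀ {n} (S : Subset n) i → enum S i ∈ S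
enum-∈ (true  ∷ S) zero    = here
enum-∈ (true  ∷ S) (suc i) = there (enum-∈ S i)
enum-∈ (false ∷ S) i       = there (enum-∈ S i)

enum-onto : ∀ {n} (S : Subset n) {v} → v ∈ S → ∃[ i ] enum S i ≡ v
enum-onto (true  ∷ S) here = zero , refl
enum-onto (true  ∷ S) (there v∈S) with enum-onto S v∈S
... | i , refl = suc i , refl
enum-onto (false ∷ S) (there v∈S) with enum-onto S v∈S
... | i , refl = i , refl

enum-injective : ∀ {n} (S : Subset n) {i j} → enum S i ≡ enum S j → i ≡ j
enum-injective (true  ∷ S) {zero}  {zero}  _  = refl
enum-injective (true  ∷ S) {suc i} {suc j} eq = cong suc (enum-injective S (suc-injective eq))
enum-injective (false ∷ S) {i} {j} eq = enum-injective S (suc-injective eq)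

module _ {n : ℕ} where

  length≤∣_∣ : ∀ (S : Subset n) {as} → Unique as → All (_∈ S) as → List.length as ≤ ∣ S ∣
  length≤∣ S ∣ [] [] = z≤n
  length≤∣ S ∣ (a∉as ∷ uniq) (a∈S ∷ as∈S) =
    ≤-trans (s≤s (length≤∣ _ ∣ uniq (All.zipWith (λ (a≢b , b∈S) → x∈p∧x≢y⇒x∈p-y b∈S (≢-sym a≢b)) (a∉as , as∈S))))
            (x∈p⇒∣p-x∣<∣p∣ a∈S)

  ∣_∣≤length : ∀ (S : Subset n) {as} → (∀ {v} → v ∈ S → v ∈ₗ as) → ∣ S ∣ ≤ List.length as
  ∣ S ∣≤length {as} S⊆as = injective⇒≤ {f = λ i → index (S⊆as (enum-∈ S i))}
    (λ {i} {j} eq → enum-injective S (index-injective (setoid (Fin n)) (S⊆as (enum-∈ S i)) (S⊆as (enum-∈ S j)) eq))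

  fresh : ∀ (S : Subset n) as → List.length as < ∣ S ∣ → ∃[ v ] v ∈ S × v ∉ₗ as
  fresh S as as<S with any? (λ v → (v ∈? S) ×-dec ¬? (v ∈ₗ? as))
  ... | yes found = found
  ... | no none   = ⊥-elim (<⇒≱ as<S (∣ S ∣≤length λ {v} v∈S →
                      decidable-stable (v ∈ₗ? as) λ v∉as → none (v , v∈S , v∉as)))

  ∈∁pair⁺ : ∀ {u v z : Fin n} → z ≢ u × z ≢ v → z ∈ ∁ (⁅ u ⁆ ∪ ⁅ v ⁆)
  ∈∁pair⁺ {u} {v} (z≢u , z≢v) = x∉p⇒x∈∁p
    ([ z≢u ∘ x∈⁅y⁆⇒x≡y u , z≢v ∘ x∈⁅y⁆⇒x≡y v ]′ ∘ x∈p∪q⁻ ⁅ u ⁆ ⁅ v ⁆)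

  ∈∁pair⁻ : ∀ {u v z : Fin n} → z ∈ ∁ (⁅ u ⁆ ∪ ⁅ v ⁆) → z ≢ u × z ≢ v
  ∈∁pair⁻ {u} {v} z∈ = (λ { refl → x∈∁p⇒x∉p z∈ (x∈p∪q⁺ (inj₁ (x∈⁅x⁆ u))) }) ,
                       (λ { refl → x∈∁p⇒x∉p z∈ (x∈p∪q⁺ {p = ⁅ u ⁆} (inj₂ (x∈⁅x⁆ v))) })

-- Modules and primality relative to a set of vertices.

module _ {n : ℕ} (G : Graph n) where
  open Graph G renaming (sym to ~-sym; irrefl to ~-irrefl)

  ~⇒≢ : ∀ {u v} → u ~ v → u ≢ v
  ~⇒≢ u~v u≡v = ~-irrefl u≡v u~v

  ModuleIn : Pred (Fin n) 0ℓ → Pred (Fin n) 0ℓ → Set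
  ModuleIn S M = ∀ {t} → S t → ¬ M t → (∀ {m} → M m → t ~ m) ⊎ (∀ {m} → M m → ¬ t ~ m)

  -- Primality of the subgraph induced on S, without the size condition,
  -- expressed on the vertices of the whole graph.
  PrimeIn : Pred (Fin n) 0ℓ → Set₁
  PrimeIn S = ∀ {M : Pred (Fin n) 0ℓ} → Decidable M → (∀ {v} → M v → S v) → ModuleIn S M →
              ∀ {a b} → M a → M b → a ≢ b → ∀ {v} → S v → M v

  PrimeIn-resp : ∀ {P Q : Pred (Fin n) 0ℓ} → (∀ {v} → P v → Q v) → (∀ {v} → Q v → P v) →
                 PrimeIn P → PrimeIn Q
  PrimeIn-resp P⊆Q Q⊆P prime M? M⊆Q mod a∈M b∈M a≢b v∈Q =
    prime M? (Q⊆P ∘ M⊆Q) (mod ∘ P⊆Q) a∈M b∈M a≢b (Q⊆P v∈Q)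

  module _ {m : ℕ} (H : Graph m) (f : Fin m → Fin n) {S : Pred (Fin n) 0ℓ}
           (f-injective : ∀ {i j} → f i ≡ f j → i ≡ j) (f-into : ∀ i → S (f i))
           (f-onto : ∀ {v} → S v → ∃[ i ] f i ≡ v)
           (f-preserves : ∀ {i j} → Graph._~_ H i j → f i ~ f j)
           (f-reflects : ∀ {i j} → f i ~ f j → Graph._~_ H i j) where

    -- `f` is an isomorphism of `H` onto the subgraph on `S`, so one transfer serves both the whole
    -- graph (`f = id`, `S = U`) and `G [ S ]` (`f = enum S`). Decidability of `M` lets its preimage
    -- be tabulated as a `Subset`.
    Prime⇒PrimeIn : Prime H → PrimeIn S
    Prime⇒PrimeIn (_ , trivial) {M} M? M⊆S mod a∈M b∈M a≢b v∈S
      with f-onto (M⊆S a∈M) | f-onto (M⊆S b∈M) | f-onto v∈S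
    ... | a , refl | b , refl | v , refl = conclude (trivial M′ M′-module)
      where
      M′ : Subset m
      M′ = tabulate (λ i → does (M? (f i)))

      M′⁺ : ∀ {i} → M (f i) → i ∈ M′
      M′⁺ = ∈-tabulate⁺ (M? ∘ f)

      M′⁻ : ∀ {i} → i ∈ M′ → M (f i)
      M′⁻ = ∈-tabulate⁻ (M? ∘ f)

      M′-module : IsModule H M′
      M′-module t t∉M′ with mod (f-into t) (t∉M′ ∘ M′⁺)
      ... | inj₁ all  = inj₁ λ u u∈M′ → f-reflects (all (M′⁻ u∈M′))
      ... | inj₂ none = inj₂ λ u u∈M′ t~u → none (M′⁻ u∈M′) (f-preserves t~u)

      conclude : Trivial H M′ → M (f v)
      conclude (inj₁ M′≡⊥) = ⊥-elim (∉⊥ (subst (a ∈_) M′≡⊥ (M′⁺ a∈M)))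
      conclude (inj₂ (inj₁ (c , M′≡⁅c⁆))) = ⊥-elim (a≢b (cong f (trans (≡c a∈M) (sym (≡c b∈M)))))
        where
        ≡c : ∀ {i} → M (f i) → i ≡ c
        ≡c {i} i∈M = x∈⁅y⁆⇒x≡y c (subst (i ∈_) M′≡⁅c⁆ (M′⁺ i∈M))
      conclude (inj₂ (inj₂ M′≡⊤)) = M′⁻ (subst (v ∈_) (sym M′≡⊤) ∈⊤)

    PrimeIn⇒Prime : 4 ≤ m → PrimeIn S → Prime H
    PrimeIn⇒Prime 4≤m prime = 4≤m , trivial
      where
      trivial : ∀ M → IsModule H M → Trivial H M
      trivial M mod with any? (_∈? M)
      ... | no empty = inj₁ (Empty-unique empty)
      ... | yes (a , a∈M) with any? (λ b → (b ∈? M) ×-dec ¬? (b ≟ a))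
      ...   | no only = inj₂ (inj₁ (a , ⊆-antisym M⊆⁅a⁆ ⁅a⁆⊆M))
        where
        M⊆⁅a⁆ : M ⊆ ⁅ a ⁆
        M⊆⁅a⁆ {b} b∈M with b ≟ a
        ... | yes refl = x∈⁅x⁆ a
        ... | no b≢a   = ⊥-elim (only (b , b∈M , b≢a))

        ⁅a⁆⊆M : ⁅ a ⁆ ⊆ M
        ⁅a⁆⊆M b∈⁅a⁆ = subst (_∈ M) (sym (x∈⁅y⁆⇒x≡y a b∈⁅a⁆)) a∈M
      ...   | yes (b , b∈M , b≢a) = inj₂ (inj₂ (⊆-antisym (λ _ → ∈⊤) (λ {v} _ → all∈M v)))
        where
        fM : Pred (Fin n) 0ℓ
        fM v = ∃[ i ] f i ≡ v × i ∈ M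

        fM-module : ModuleIn S fM
        fM-module t∈S t∉fM with f-onto t∈S
        ... | t , refl with mod t (λ t∈M → t∉fM (t , refl , t∈M))
        ...   | inj₁ all  = inj₁ λ { (u , refl , u∈M) → f-preserves (all u u∈M) }
        ...   | inj₂ none = inj₂ λ { (u , refl , u∈M) → none u u∈M ∘ f-reflects }

        all∈M : ∀ v → v ∈ M
        all∈M v with prime (λ w → any? λ i → (f i ≟ w) ×-dec (i ∈? M)) (λ { (i , refl , _) → f-into i })
                           fM-module (a , refl , a∈M) (b , refl , b∈M) (b≢a ∘ sym ∘ f-injective) (f-into v)
        ... | i , fi≡fv , i∈M = subst (_∈ M) (f-injective fi≡fv) i∈M

  Prime⇒PrimeIn-U : Prime G → PrimeIn U
  Prime⇒PrimeIn-U = Prime⇒PrimeIn G id id (λ _ → tt) (λ _ → _ , refl) id id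

  PrimeIn-U⇒Prime : 4 ≤ n → PrimeIn U → Prime G
  PrimeIn-U⇒Prime = PrimeIn⇒Prime G id {U} id (λ _ → tt) (λ _ → _ , refl) id id

  Prime⇒PrimeIn-∈ : ∀ S → Prime (G [ S ]) → PrimeIn (_∈ S)
  Prime⇒PrimeIn-∈ S = Prime⇒PrimeIn (G [ S ]) (enum S) (enum-injective S) (enum-∈ S) (enum-onto S) id id

  PrimeIn-∈⇒Prime : ∀ S → 4 ≤ ∣ S ∣ → PrimeIn (_∈ S) → Prime (G [ S ])
  PrimeIn-∈⇒Prime S = PrimeIn⇒Prime (G [ S ]) (enum S) (enum-injective S) (enum-∈ S) (enum-onto S) id id

  -- Pendant vertices and degrees.

  Pendant : Rel (Fin n) 0ℓ
  Pendant u w = u ~ w × (∀ z → u ~ z → z ≡ w)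

  pendant? : ∀ u w → Dec (Pendant u w)
  pendant? u w = (u ~? w) ×-dec all? λ z → (u ~? z) →-dec (z ≟ w)

  neighbours⁺ : ∀ {u v} → u ~ v → v ∈ neighbours G u
  neighbours⁺ {u} = ∈-tabulate⁺ (u ~?_)

  neighbours⁻ : ∀ {u v} → v ∈ neighbours G u → u ~ v
  neighbours⁻ {u} = ∈-tabulate⁻ (u ~?_)

  -- Together with `pendant⇒leaf`, this lets leaves be handled through their unique neighbour
  -- instead of through cardinalities.
  leaf⇒pendant : ∀ {u} → Leaf G u → ∃[ w ] Pendant u w
  leaf⇒pendant {u} leaf with fresh (neighbours G u) [] (≤-reflexive (sym leaf))
  ... | w , w∈ , _ = w , neighbours⁻ w∈ , only
    where
    only : ∀ z → u ~ z → z ≡ w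
    only z u~z = decidable-stable (z ≟ w) λ z≢w →
      <⇒≱ (≤-reflexive (cong suc leaf))
          (length≤∣ neighbours G u ∣ ((z≢w ∷ []) ∷ [] ∷ []) (neighbours⁺ u~z ∷ w∈ ∷ []))

  pendant⇒leaf : ∀ {u w} → Pendant u w → Leaf G u
  pendant⇒leaf {u} {w} (u~w , only) = ≤-antisym
    (∣ neighbours G u ∣≤length {as = w ∷ []} (λ z∈ → here (only _ (neighbours⁻ z∈))))
    (length≤∣ neighbours G u ∣ ([] ∷ []) (neighbours⁺ u~w ∷ []))

  nonleaf⇒other : ∀ {u v} → ¬ Leaf G u → u ~ v → ∃[ w ] u ~ w × w ≢ v
  nonleaf⇒other {u} {v} ¬leaf u~v with any? (λ w → (u ~? w) ×-dec ¬? (w ≟ v))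
  ... | yes found = found
  ... | no none   = ⊥-elim (¬leaf (pendant⇒leaf (u~v , λ z u~z →
                      decidable-stable (z ≟ v) λ z≢v → none (z , u~z , z≢v))))

  degree≡2⁺ : ∀ {v a b} → v ~ a → v ~ b → a ≢ b → (∀ z → v ~ z → z ≡ a ⊎ z ≡ b) → degree G v ≡ 2
  degree≡2⁺ {v} {a} {b} v~a v~b a≢b only = ≤-antisym
    (∣ neighbours G v ∣≤length (λ z∈ → listed (only _ (neighbours⁻ z∈))))
    (length≤∣ neighbours G v ∣ ((a≢b ∷ []) ∷ [] ∷ []) (neighbours⁺ v~a ∷ neighbours⁺ v~b ∷ []))
    where
    listed : ∀ {z} → z ≡ a ⊎ z ≡ b → z ∈ₗ (a ∷ b ∷ [])
    listed (inj₁ z≡a) = here z≡a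
    listed (inj₂ z≡b) = there (here z≡b)

  degree≡2⁻ : ∀ {v a b} → degree G v ≡ 2 → v ~ a → v ~ b → a ≢ b → ∀ z → v ~ z → z ≡ a ⊎ z ≡ b
  degree≡2⁻ {v} {a} {b} deg v~a v~b a≢b z v~z with z ≟ a | z ≟ b
  ... | yes z≡a | _       = inj₁ z≡a
  ... | _       | yes z≡b = inj₂ z≡b
  ... | no z≢a  | no z≢b  = ⊥-elim (<⇒≱ (≤-reflexive (cong suc deg))
    (length≤∣ neighbours G v ∣ ((z≢a ∷ z≢b ∷ []) ∷ (a≢b ∷ []) ∷ [] ∷ [])
                               (neighbours⁺ v~z ∷ neighbours⁺ v~a ∷ neighbours⁺ v~b ∷ [])))

  -- Walks, paths and walks avoiding a vertex.

  start∈vertices : ∀ {u v} (w : Walk G u v) → u ∈ₗ vertices G w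
  start∈vertices ε       = here refl
  start∈vertices (_ ◅ _) = here refl

  end∈vertices : ∀ {u v} (w : Walk G u v) → v ∈ₗ vertices G w
  end∈vertices ε       = here refl
  end∈vertices (_ ◅ w) = there (end∈vertices w)

  suffix : ∀ {u v x} (p : Path G u v) → x ∈ₗ vertices G (proj₁ p) →
           Σ (Path G x v) λ q → ∀ {z} → z ∈ₗ vertices G (proj₁ q) → z ∈ₗ vertices G (proj₁ p)
  suffix (ε , uniq)         (here refl) = (ε , uniq) , id
  suffix (e ◅ w , uniq)     (here refl) = (e ◅ w , uniq) , id
  suffix (e ◅ w , _ ∷ uniq) (there x∈) with suffix (w , uniq) x∈
  ... | q , q⊆w = q , there ∘ q⊆w

  -- If the first vertex recurs on the shortened tail, everything before that recurrence is dropped.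
  -- The inclusion of vertices is recorded so that a vertex missed by the walk is also missed by the
  -- path.
  shorten : ∀ {u v} (w : Walk G u v) →
            Σ (Path G u v) λ p → ∀ {z} → z ∈ₗ vertices G (proj₁ p) → z ∈ₗ vertices G w
  shorten ε = (ε , [] ∷ []) , id
  shorten {u} (e ◅ w) with shorten w
  ... | p , p⊆w with u ∈ₗ? vertices G (proj₁ p)
  ...   | yes u∈p with suffix p u∈p
  ...     | q , q⊆p = q , there ∘ p⊆w ∘ q⊆p
  shorten {u} (e ◅ w) | (w′ , uniq) , p⊆w | no u∉p =
    (e ◅ w′ , ¬Any⇒All¬ _ u∉p ∷ uniq) , λ { (here z≡u) → here z≡u ; (there z∈) → there (p⊆w z∈) }

  distance-two⇒midpoint : ∀ {u v} → Distance G u v 2 → u ≢ v × ∃[ w ] u ~ w × w ~ v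
  distance-two⇒midpoint (((u~w ◅ w~v ◅ ε , (_ ∷ u≢v ∷ []) ∷ _) , _) , _) = u≢v , _ , u~w , w~v
  distance-two⇒midpoint (((ε , _) , ()) , _)
  distance-two⇒midpoint (((_ ◅ ε , _) , ()) , _)
  distance-two⇒midpoint (((_ ◅ _ ◅ _ ◅ _ , _) , ()) , _)

  -- Adjacency after deletion of `z`. For a neighbour `a` of `z`, the vertices reachable from `a`
  -- under `Star (Avoiding z)` form the branch of `a` at `z`.
  Avoiding : Fin n → Rel (Fin n) 0ℓ
  Avoiding z u v = u ~ v × z ≢ u × z ≢ v

  avoiding-sym : ∀ {z u v} → Avoiding z u v → Avoiding z v u
  avoiding-sym (u~v , z≢u , z≢v) = ~-sym u~v , z≢v , z≢u

  prefix : ∀ {z u v x} (w : Walk G u v) → z ∉ₗ vertices G w → x ∈ₗ vertices G w → Star (Avoiding z) u x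
  prefix ε       z∉w (here refl) = ε
  prefix (e ◅ w) z∉w (here refl) = ε
  prefix (e ◅ w) z∉w (there x∈w) =
    (e , z∉w ∘ here , λ { refl → z∉w (there (start∈vertices w)) }) ◅ prefix w (z∉w ∘ there) x∈w

  avoiding⇒walk : ∀ {z u v} → z ≢ u → Star (Avoiding z) u v → Σ (Walk G u v) λ w → z ∉ₗ vertices G w
  avoiding⇒walk z≢u ε = ε , λ { (here z≡u) → z≢u z≡u }
  avoiding⇒walk z≢u ((u~x , _ , z≢x) ◅ s) with avoiding⇒walk z≢x s
  ... | w , z∉w = u~x ◅ w , λ { (here z≡u) → z≢u z≡u ; (there z∈w) → z∉w z∈w }

-- Paths and branches in trees.

module _ {n : ℕ} (T : Graph n) (tree : Tree T) where
  open Graph T renaming (sym to ~-sym; irrefl to ~-irrefl)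

  connected = proj₁ tree
  acyclic   = proj₂ tree

  -- Otherwise the connection shortens to a path missing `v`, which the two edges at `v` close up to
  -- a cycle. Every later use of acyclicity goes through this lemma.
  branch-unique : ∀ {v a b} → v ~ a → v ~ b → Star (Avoiding T v) a b → a ≡ b
  branch-unique {v} {a} v~a v~b s with avoiding⇒walk T (~⇒≢ T v~a) s
  ... | w , v∉w with shorten T w
  ...   | (ε , _) , _ = refl
  ...   | (e ◅ p , uniq) , p⊆w =
    ⊥-elim (acyclic (v~a ◅ e ◅ p , ¬Any⇒All¬ _ (v∉w ∘ p⊆w) ∷ uniq) (s≤s (s≤s z≤n)) (~-sym v~b))

  triangle-free : ∀ {u v w} → u ~ v → u ~ w → ¬ v ~ w
  triangle-free u~v u~w v~w =
    ~-irrefl (branch-unique u~v u~w ((v~w , ~⇒≢ T u~v , ~⇒≢ T u~w) ◅ ε)) v~w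

  -- If `u` and `v` were distinct, the neighbours `a` and `b` of `u` would lie in one branch at `u`,
  -- joined through `v`.
  square-free : ∀ {u v a b} → u ~ a → v ~ a → u ~ b → v ~ b → a ≢ b → u ≡ v
  square-free {u} {v} u~a v~a u~b v~b a≢b = decidable-stable (u ≟ v) λ u≢v →
    a≢b (branch-unique u~a u~b
      ((~-sym v~a , ~⇒≢ T u~a , u≢v) ◅ (v~b , u≢v , ~⇒≢ T u~b) ◅ ε))

  -- The tails of both paths miss the starting vertex and share their end, so the second vertices
  -- lie in one branch and coincide; induction does the rest. Any path between two vertices
  -- therefore realises their distance.
  pathLength-unique : ∀ {u v} (p q : Path T u v) → pathLength T p ≡ pathLength T q
  pathLength-unique (w , uniq) (w′ , uniq′) = go w w′ uniq uniq′
    where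
    go : ∀ {u v} (w w′ : Walk T u v) → Unique (vertices T w) → Unique (vertices T w′) → length T w ≡ length T w′
    go ε ε _ _ = refl
    go ε (_ ◅ w′) _ (u∉w′ ∷ _) = ⊥-elim (All¬⇒¬Any u∉w′ (end∈vertices T w′))
    go (_ ◅ w) ε (u∉w ∷ _) _   = ⊥-elim (All¬⇒¬Any u∉w (end∈vertices T w))
    go (e ◅ w) (e′ ◅ w′) (u∉w ∷ uniq) (u∉w′ ∷ uniq′)
      with branch-unique e e′ (prefix T w (All¬⇒¬Any u∉w) (end∈vertices T w) ◅◅
             reverse (avoiding-sym T) (prefix T w′ (All¬⇒¬Any u∉w′) (end∈vertices T w′)))
    ... | refl = cong suc (go w w′ uniq uniq′)

  distance : ∀ {u v} (p : Path T u v) → Distance T u v (pathLength T p)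
  distance p = (p , refl) , λ q → ≤-reflexive (pathLength-unique p q)

  neighbour : ∀ {u v} → u ≢ v → ∃[ w ] u ~ w
  neighbour {u} {v} u≢v with connected u v
  ... | ε , _       = ⊥-elim (u≢v refl)
  ... | (e ◅ _) , _ = _ , e

  closed⇒full : ∀ {M : Pred (Fin n) 0ℓ} → (∀ {u v} → M u → u ~ v → M v) → ∀ {a v} → M a → M v
  closed⇒full {M} closed {a} {v} a∈M = go (proj₁ (connected a v)) a∈M
    where
    go : ∀ {u v} → Walk T u v → M u → M v
    go ε       u∈M = u∈M
    go (e ◅ w) u∈M = go w (closed u∈M e)

  -- Membership is decided by whether the path from `v` to the given vertex starts with the edge to
  -- `a`.
  branch? : ∀ {v a} → v ~ a → Decidable (Star (Avoiding T v) a)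
  branch? {v} {a} v~a w with connected v w
  ... | ε , _ = no λ s → proj₂ (avoiding⇒walk T (~⇒≢ T v~a) s) (end∈vertices T _)
  ... | _◅_ {j = b} v~b p , v∉p ∷ _ with b ≟ a
  ...   | yes refl = yes (prefix T p (All¬⇒¬Any v∉p) (end∈vertices T p))
  ...   | no b≢a   = no λ s → b≢a (sym (branch-unique v~a v~b
                       (s ◅◅ reverse (avoiding-sym T) (prefix T p (All¬⇒¬Any v∉p) (end∈vertices T p)))))

  -- Walking away from `v` never returns to a visited vertex, so by finiteness it stops, and it can
  -- stop only at a leaf.
  branch-leaf : ∀ {v a} → v ~ a → ∃[ u ] Leaf T u × Star (Avoiding T v) a u
  branch-leaf {v} {a} v~a = extend n (~-sym v~a) ε ((~⇒≢ T (~-sym v~a) ∷ []) ∷ [] ∷ [])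
                                   (m<m+n n (s≤s z≤n)) ε
    where
    -- The path runs from the current vertex `w` through its predecessor `q` back to `v`. The fuel
    -- plus the number of its vertices stays above `n`, so running out of fuel would give more than
    -- `n` distinct vertices.
    extend : ∀ fuel {w q} → w ~ q → (p : Walk T q v) → Unique (w ∷ vertices T p) →
             n < fuel + List.length (w ∷ vertices T p) →
             Star (Avoiding T v) a w → ∃[ u ] Leaf T u × Star (Avoiding T v) a u
    extend zero {w} w~q p uniq long s = ⊥-elim (<⇒≱ long
      (subst (List.length (w ∷ vertices T p) ≤_) (∣⊤∣≡n n) (length≤∣ ⊤ ∣ uniq (All.universal (λ _ → ∈⊤) _))))
    extend (suc fuel) {w} {q} w~q p uniq@(w∉p ∷ _) long s with degree T w ≟ℕ 1
    ... | yes leaf = w , leaf , s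
    ... | no ¬leaf with nonleaf⇒other T ¬leaf w~q
    ...   | x , w~x , x≢q = extend fuel (~-sym w~x) (w~q ◅ p) (¬Any⇒All¬ _ x∉ ∷ uniq)
              (subst (n <_) (sym (+-suc fuel _)) long)
              (s ◅◅ (w~x , ≢-sym (All.lookup w∉p (end∈vertices T p)) , x≢v) ◅ ε)
      where
      x∉ : x ∉ₗ (w ∷ vertices T p)
      x∉ (here x≡w)  = ~-irrefl (sym x≡w) w~x
      -- If `x` were on the old path, it would lie in the same branch at `w` as `q`, and so equal
      -- `q`.
      x∉ (there x∈p) = x≢q (sym (branch-unique w~q w~x (prefix T p (All¬⇒¬Any w∉p) x∈p)))

      x≢v : v ≢ x
      x≢v refl = x∉ (there (end∈vertices T p))

  -- Twin leaves, modules of trees and deletion of leaves.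

  NoTwins : Set
  NoTwins = ∀ {u v w} → Pendant T u w → Pendant T v w → u ≡ v

  -- Two elements of a module M have a common neighbour outside M if any at
  -- all; it is unique because a tree has no 4-cycle, and M is then independent
  -- because a tree has no triangle.
  module-dichotomy : ∀ {S M : Pred (Fin n) 0ℓ} → Decidable S → Decidable M → (∀ {v} → M v → S v) →
    ModuleIn T S M → ∀ {a b} → M a → M b → a ≢ b →
    (∀ {u v} → M u → S v → u ~ v → M v) ⊎
    (∃[ y ] S y × ¬ M y × (∀ {m} → M m → m ~ y × (∀ z → S z → m ~ z → z ≡ y)))
  module-dichotomy {S} {M} S? M? M⊆S mod {a} {b} a∈M b∈M a≢b
    with any? (λ t → S? t ×-dec (¬? (M? t) ×-dec (t ~? a)))
  ... | no none = inj₁ closed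
    where
    closed : ∀ {u v} → M u → S v → u ~ v → M v
    closed {u} {v} u∈M v∈S u~v = decidable-stable (M? v) λ v∉M → case-mod v∉M (mod v∈S v∉M)
      where
      case-mod : ¬ M v → (∀ {m} → M m → v ~ m) ⊎ (∀ {m} → M m → ¬ v ~ m) → _
      case-mod v∉M (inj₁ all)  = none (v , v∈S , v∉M , all a∈M)
      case-mod v∉M (inj₂ none) = none u∈M (~-sym u~v)
  ... | yes (y , y∈S , y∉M , y~a) = inj₂ (y , y∈S , y∉M , λ m∈M → ~-sym (joined y∈S y∉M y~a a∈M m∈M) , only m∈M)
    where
    joined : ∀ {t c m} → S t → ¬ M t → t ~ c → M c → M m → t ~ m
    joined t∈S t∉M t~c c∈M m∈M with mod t∈S t∉M
    ... | inj₁ all  = all m∈M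
    ... | inj₂ none = ⊥-elim (none c∈M t~c)

    only : ∀ {m} → M m → ∀ z → S z → m ~ z → z ≡ y
    only m∈M z z∈S m~z with M? z
    ... | yes z∈M = ⊥-elim (triangle-free (joined y∈S y∉M y~a a∈M m∈M) (joined y∈S y∉M y~a a∈M z∈M) m~z)
    ... | no z∉M  = square-free (joined z∈S z∉M (~-sym m~z) m∈M a∈M) y~a
                                (joined z∈S z∉M (~-sym m~z) m∈M b∈M) (joined y∈S y∉M y~a a∈M b∈M) a≢b

  -- Of the two alternatives for a module, a set closed under adjacency is everything by
  -- connectedness, and pendant vertices at a common neighbour are twins.
  NoTwins⇒PrimeIn : NoTwins → PrimeIn T U
  NoTwins⇒PrimeIn noTwins M? M⊆U mod {a} {b} a∈M b∈M a≢b _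
    with module-dichotomy (λ _ → yes tt) M? M⊆U mod a∈M b∈M a≢b
  ... | inj₁ closed = closed⇒full (λ u∈M u~v → closed u∈M tt u~v) a∈M
  ... | inj₂ (y , _ , _ , pendants) = ⊥-elim (a≢b (noTwins (pendant a∈M) (pendant b∈M)))
    where
    pendant : ∀ {m} → _ → Pendant T m y
    pendant m∈M with pendants m∈M
    ... | m~y , only = m~y , λ z → only z tt

  -- The obstruction to the primality of T - u, where u is a leaf with support
  -- vertex v: in T - u the vertex v is a twin of the leaf m.
  Blocks : (v u y m : Fin n) → Set
  Blocks v u y m = v ~ y × y ≢ u × (∀ z → v ~ z → z ≡ u ⊎ z ≡ y) × Pendant T m y × m ≢ v

  blocks? : ∀ v u → Dec (∃[ y ] ∃[ m ] Blocks v u y m)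
  blocks? v u = any? λ y → any? λ m →
    (v ~? y) ×-dec (¬? (y ≟ u) ×-dec ((all? λ z → (v ~? z) →-dec ((z ≟ u) ⊎-dec (z ≟ y)))
    ×-dec (pendant? T m y ×-dec ¬? (m ≟ v))))

  -- A module missing `v` remains a module of `T`, since `u` sees none of it; primality then forces
  -- `u` into it. For a module containing `v`, closure under adjacency survives adding `u`, while in
  -- the pendant case `v` and another element of the module form the obstruction `Blocks`.
  delete-leaf : PrimeIn T U → ∀ {u v} → Pendant T u v → ¬ (∃[ y ] ∃[ m ] Blocks v u y m) → PrimeIn T (_≢ u)
  delete-leaf prime {u} {v} (u~v , u-only) ¬blocked {M} M? M⊆S mod {a} {b} a∈M b∈M a≢b {x} x≢u with M? v
  ... | no v∉M = ⊥-elim (M⊆S (prime M? (λ _ → tt) mod-U a∈M b∈M a≢b tt) refl)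
    where
    mod-U : ModuleIn T U M
    mod-U {t} _ t∉M with t ≟ u
    ... | yes refl = inj₂ λ {m} m∈M u~m → v∉M (subst M (u-only m u~m) m∈M)
    ... | no t≢u   = mod t≢u t∉M
  ... | yes v∈M with module-dichotomy (λ t → ¬? (t ≟ u)) M? M⊆S mod a∈M b∈M a≢b
  ...   | inj₁ closed = strip (closed⇒full {M+u} closed-U (inj₁ a∈M))
    where
    M+u : Pred (Fin n) 0ℓ
    M+u t = M t ⊎ t ≡ u

    closed-U : ∀ {p q} → M+u p → p ~ q → M+u q
    closed-U {q = q} (inj₁ p∈M) p~q with q ≟ u
    ... | yes q≡u = inj₂ q≡u
    ... | no q≢u  = inj₁ (closed p∈M q≢u p~q)
    closed-U (inj₂ refl) u~q = inj₁ (subst M (sym (u-only _ u~q)) v∈M)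

    strip : M+u x → M x
    strip (inj₁ x∈M) = x∈M
    strip (inj₂ x≡u) = ⊥-elim (x≢u x≡u)
  ...   | inj₂ (y , y≢u , y∉M , pendants) = ⊥-elim (another (b ≟ v))
    where
    blocked : ∀ {m} → M m → m ≢ v → ∃[ y ] ∃[ m ] Blocks v u y m
    blocked {m} m∈M m≢v = y , m , proj₁ (pendants v∈M) , y≢u , v-only , (proj₁ (pendants m∈M) , m-only) , m≢v
      where
      v-only : ∀ z → v ~ z → z ≡ u ⊎ z ≡ y
      v-only z v~z with z ≟ u
      ... | yes z≡u = inj₁ z≡u
      ... | no z≢u  = inj₂ (proj₂ (pendants v∈M) z z≢u v~z)

      m-only : ∀ z → m ~ z → z ≡ y
      m-only z m~z = proj₂ (pendants m∈M) z (λ { refl → m≢v (u-only m (~-sym m~z)) }) m~z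

    another : Dec (b ≡ v) → _
    another (yes refl) = ¬blocked (blocked a∈M a≢b)
    another (no b≢v)   = ¬blocked (blocked b∈M b≢v)

  -- Only `y` links `v` to the remaining vertices. A module missing `y` is thus one of `T`; if it
  -- contains `y` and is closed, adding `u` and `v` keeps it closed.
  delete-leaf-and-support : PrimeIn T U → ∀ {u v y m} → Pendant T u v → Blocks v u y m →
                            PrimeIn T (λ t → t ≢ u × t ≢ v)
  delete-leaf-and-support prime {u} {v} {y} {m} (u~v , u-only) (v~y , y≢u , v-only , (m~y , m-only) , m≢v)
                          {M} M? M⊆S mod {a} {b} a∈M b∈M a≢b {x} (x≢u , x≢v) with M? y
  ... | no y∉M = ⊥-elim (proj₁ (M⊆S (prime M? (λ _ → tt) mod-U a∈M b∈M a≢b tt)) refl)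
    where
    mod-U : ModuleIn T U M
    mod-U {t} _ t∉M with t ≟ u | t ≟ v
    ... | yes refl | _ = inj₂ λ {q} q∈M u~q → proj₂ (M⊆S q∈M) (u-only q u~q)
    ... | no t≢u | no t≢v = mod (t≢u , t≢v) t∉M
    ... | no _ | yes refl = inj₂ none
      where
      none : ∀ {q} → M q → ¬ v ~ q
      none {q} q∈M v~q with v-only q v~q
      ... | inj₁ q≡u  = proj₁ (M⊆S q∈M) q≡u
      ... | inj₂ refl = y∉M q∈M
  ... | yes y∈M with module-dichotomy (λ t → ¬? (t ≟ u) ×-dec ¬? (t ≟ v)) M? M⊆S mod a∈M b∈M a≢b
  ...   | inj₁ closed = strip (closed⇒full {M+uv} closed-U (inj₁ a∈M))
    where
    M+uv : Pred (Fin n) 0ℓ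
    M+uv t = M t ⊎ t ≡ u ⊎ t ≡ v

    closed-U : ∀ {p q} → M+uv p → p ~ q → M+uv q
    closed-U {q = q} (inj₁ p∈M) p~q with q ≟ u | q ≟ v
    ... | yes q≡u | _       = inj₂ (inj₁ q≡u)
    ... | no _    | yes q≡v = inj₂ (inj₂ q≡v)
    ... | no q≢u  | no q≢v  = inj₁ (closed p∈M (q≢u , q≢v) p~q)
    closed-U (inj₂ (inj₁ refl)) u~q = inj₂ (inj₂ (u-only _ u~q))
    closed-U {q = q} (inj₂ (inj₂ refl)) v~q with v-only q v~q
    ... | inj₁ q≡u  = inj₂ (inj₁ q≡u)
    ... | inj₂ refl = inj₁ y∈M

    strip : M+uv x → M x
    strip (inj₁ x∈M)        = x∈M
    strip (inj₂ (inj₁ x≡u)) = ⊥-elim (x≢u x≡u)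
    strip (inj₂ (inj₂ x≡v)) = ⊥-elim (x≢v x≡v)
  ...   | inj₂ (y′ , _ , _ , pendants) = ⊥-elim (a≢b (trans (≡y a∈M) (sym (≡y b∈M))))
    where
    m≢u : m ≢ u
    m≢u refl = ~-irrefl (sym (u-only y m~y)) v~y

    -- The leaf `m` survives the deletion and is adjacent to `y`, so the common neighbour `y′` is
    -- `m`. As `m` sees only `y`, the module cannot have two elements.
    ≡y : ∀ {q} → M q → q ≡ y
    ≡y {q} q∈M = m-only q (~-sym (subst (q ~_)
      (sym (proj₂ (pendants y∈M) m (m≢u , m≢v) (~-sym m~y))) (proj₁ (pendants q∈M))))

  -- Trees with at least five vertices.

  module _ (5≤n : 5 ≤ n) where

    fresh-U : ∀ (as : List (Fin n)) → List.length as < n → ∃[ v ] v ∉ₗ as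
    fresh-U as as<n with fresh ⊤ as (subst (List.length as <_) (sym (∣⊤∣≡n n)) as<n)
    ... | v , _ , v∉as = v , v∉as

    PrimeIn⇒not-pair : PrimeIn T U → ∀ {u v} → u ≢ v →
                       ¬ (ModuleIn T U (λ t → t ≡ u ⊎ t ≡ v))
    PrimeIn⇒not-pair prime {u} {v} u≢v mod
      with fresh-U (u ∷ v ∷ []) (≤-trans (s≤s (s≤s (s≤s z≤n))) 5≤n)
    ... | w , w∉ with prime (λ t → (t ≟ u) ⊎-dec (t ≟ v)) (λ _ → tt) mod (inj₁ refl) (inj₂ refl) u≢v {w} tt
    ...   | inj₁ w≡u = w∉ (here w≡u)
    ...   | inj₂ w≡v = w∉ (there (here w≡v))

    PrimeIn⇒NoTwins : PrimeIn T U → NoTwins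
    PrimeIn⇒NoTwins prime {u} {v} {w} (u~w , u-only) (v~w , v-only) =
      decidable-stable (u ≟ v) λ u≢v → PrimeIn⇒not-pair prime u≢v mod
      where
      mod : ModuleIn T U (λ t → t ≡ u ⊎ t ≡ v)
      mod {t} _ _ with t ≟ w
      ... | yes refl = inj₁ λ { (inj₁ refl) → ~-sym u~w ; (inj₂ refl) → ~-sym v~w }
      ... | no t≢w   = inj₂ λ { (inj₁ refl) t~u → t≢w (u-only t (~-sym t~u))
                              ; (inj₂ refl) t~v → t≢w (v-only t (~-sym t~v)) }

    -- Two adjacent leaves see nothing else, so no outside vertex meets the pair, which is then a
    -- nontrivial module.
    PrimeIn⇒leaves-nonadjacent : PrimeIn T U → ∀ {u v} → Pendant T u v → ¬ Pendant T v u
    PrimeIn⇒leaves-nonadjacent prime {u} {v} (u~v , u-only) (_ , v-only) =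
      PrimeIn⇒not-pair prime (~⇒≢ T u~v) mod
      where
      mod : ModuleIn T U (λ t → t ≡ u ⊎ t ≡ v)
      mod {t} _ t∉ = inj₂ λ { (inj₁ refl) t~u → t∉ (inj₂ (u-only t (~-sym t~u)))
                            ; (inj₂ refl) t~v → t∉ (inj₁ (v-only t (~-sym t~v))) }

    -- The four vertices are y, m, a vertex p outside u, v, y, m, and a neighbour
    -- q ≠ y of p: without such a q, p would be a twin of m.
    blocks⇒four : NoTwins → ∀ {u v y m} → Pendant T u v → Blocks v u y m → 4 ≤ ∣ ∁ (⁅ u ⁆ ∪ ⁅ v ⁆) ∣
    blocks⇒four noTwins {u} {v} {y} {m} (u~v , u-only) (v~y , y≢u , v-only , (m~y , m-only) , m≢v)
      with fresh-U (u ∷ v ∷ y ∷ m ∷ []) 5≤n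
    ... | p , p∉ with any? (λ q → (p ~? q) ×-dec ¬? (q ≟ y))
    ...   | no none = ⊥-elim (p∉ (there (there (there (here (noTwins (p~y , p-only) (m~y , m-only)))))))
      where
      p-only : ∀ z → p ~ z → z ≡ y
      p-only z p~z = decidable-stable (z ≟ y) λ z≢y → none (z , p~z , z≢y)

      p~y : p ~ y
      p~y with neighbour {p} {y} (λ p≡y → p∉ (there (there (here p≡y))))
      ... | z , p~z = subst (p ~_) (p-only z p~z) p~z
    ...   | yes (q , p~q , q≢y) = length≤∣ ∁ (⁅ u ⁆ ∪ ⁅ v ⁆) ∣
        ((≢-sym (~⇒≢ T m~y) ∷ (λ { refl → p∉ (there (there (here refl))) }) ∷ ≢-sym q≢y ∷ []) ∷
         ((λ { refl → p∉ (there (there (there (here refl)))) }) ∷ m≢q ∷ []) ∷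
         (~⇒≢ T p~q ∷ []) ∷ [] ∷ [])
        (∈∁pair⁺ (y≢u , ≢-sym (~⇒≢ T v~y)) ∷ ∈∁pair⁺ (m≢u , m≢v) ∷
         ∈∁pair⁺ (p∉ ∘ here , λ p≡v → p∉ (there (here p≡v))) ∷ ∈∁pair⁺ (q≢u , q≢v) ∷ [])
      where
      m≢u : m ≢ u
      m≢u refl = ~-irrefl (sym (u-only y m~y)) v~y

      m≢q : m ≢ q
      m≢q refl = p∉ (there (there (here (m-only p (~-sym p~q)))))

      q≢u : q ≢ u
      q≢u refl = p∉ (there (here (u-only p (~-sym p~q))))

      q≢v : q ≢ v
      q≢v refl with v-only p (~-sym p~q)
      ... | inj₁ p≡u = p∉ (here p≡u)
      ... | inj₂ p≡y = p∉ (there (there (here p≡y)))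

    -- If v and y both have degree two, the tree is the path u, v, y, m.
    ¬blocks-both-ways : ∀ {u v y m} → Pendant T u v → Pendant T m y →
      (∀ z → v ~ z → z ≡ u ⊎ z ≡ y) → ¬ (∀ z → y ~ z → z ≡ m ⊎ z ≡ v)
    ¬blocks-both-ways {u} {v} {y} {m} (u~v , u-only) (m~y , m-only) v-only y-only
      with fresh-U (u ∷ v ∷ y ∷ m ∷ []) 5≤n
    ... | p , p∉ = p∉ (closed⇒full {_∈ₗ (u ∷ v ∷ y ∷ m ∷ [])} closed (here refl))
      where
      closed : ∀ {s t} → s ∈ₗ (u ∷ v ∷ y ∷ m ∷ []) → s ~ t → t ∈ₗ (u ∷ v ∷ y ∷ m ∷ [])
      closed (here refl) s~t = there (here (u-only _ s~t))
      closed (there (here refl)) s~t with v-only _ s~t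
      ... | inj₁ t≡u = here t≡u
      ... | inj₂ t≡y = there (there (here t≡y))
      closed (there (there (here refl))) s~t with y-only _ s~t
      ... | inj₁ t≡m = there (there (there (here t≡m)))
      ... | inj₂ t≡v = there (here t≡v)
      closed (there (there (there (here refl)))) s~t = there (there (here (m-only _ s~t)))

    -- Minimality and the three assertions.

    module _ {k : ℕ} (x : Fin k → Fin n) where

      ∈X? : Decidable ⟦ x ⟧
      ∈X? v = any? λ i → x i ≟ v

      assertion₁⇒NoTwins : Assertion₁ T x → NoTwins
      assertion₁⇒NoTwins a₁ {u} {v} {w} pu@(u~w , _) pv@(v~w , _) = decidable-stable (u ≟ v) λ u≢v →
        close u≢v (a₁ u v (pendant⇒leaf T pu) (pendant⇒leaf T pv) u≢v)
        where
        close : u ≢ v → ¬ (∃[ d ] (Distance T u v d × 3 ≤ d))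
        close u≢v (d , (_ , shortest) , 3≤d) = <⇒≱ 3≤d (shortest
          (u~w ◅ ~-sym v~w ◅ ε , (~⇒≢ T u~w ∷ u≢v ∷ []) ∷ (≢-sym (~⇒≢ T v~w) ∷ []) ∷ [] ∷ []))

      -- A connecting path of length one gives adjacent leaves, one of length two gives twins; both
      -- contradict primality.
      PrimeIn⇒assertion₁ : PrimeIn T U → Assertion₁ T x
      PrimeIn⇒assertion₁ prime u v leaf-u leaf-v u≢v
        with leaf⇒pendant T leaf-u | leaf⇒pendant T leaf-v | connected u v
      ... | _ | _ | ε , _ = ⊥-elim (u≢v refl)
      ... | a , pu@(_ , u-only) | b , pv@(_ , v-only) | (u~v ◅ ε) , _ =
        ⊥-elim (PrimeIn⇒leaves-nonadjacent prime (subst (Pendant T u) (sym (u-only v u~v)) pu)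
                                                 (subst (Pendant T v) (sym (v-only u (~-sym u~v))) pv))
      ... | a , pu@(_ , u-only) | b , pv@(_ , v-only) | (u~w ◅ w~v ◅ ε) , _ =
        ⊥-elim (u≢v (PrimeIn⇒NoTwins prime (subst (Pendant T u) (sym (u-only _ u~w)) pu)
                                           (subst (Pendant T v) (sym (v-only _ (~-sym w~v))) pv)))
      ... | _ | _ | p@((_ ◅ _ ◅ _ ◅ _) , _) = pathLength T p , distance p , s≤s (s≤s (s≤s z≤n))

      minimal⇒¬PrimeIn : Minimal T ⟦ x ⟧ → ∀ S → 4 ≤ ∣ S ∣ → (∀ {v} → ⟦ x ⟧ v → v ∈ S) →
                         ∀ {u} → u ∉ S → ¬ PrimeIn T (_∈ S)
      minimal⇒¬PrimeIn (_ , minimal) S 4≤S X⊆S {u} u∉S prime =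
        minimal S (λ _ → X⊆S) ((λ _ → ∈⊤) , u , ∈⊤ , u∉S) (PrimeIn-∈⇒Prime T S 4≤S prime)

      -- An unblocked leaf outside the prescribed set could be deleted, leaving a smaller prime
      -- subgraph.
      minimal⇒blocked : Minimal T ⟦ x ⟧ → ∀ {u v} → Pendant T u v → ¬ ⟦ x ⟧ u → ∃[ y ] ∃[ m ] Blocks v u y m
      minimal⇒blocked min@(prime , _) {u} {v} pu u∉X =
        decidable-stable (blocks? v u) λ ¬blocked →
          minimal⇒¬PrimeIn min (∁ ⁅ u ⁆) four (λ z∈X → ∈∁ λ { refl → u∉X z∈X })
            (λ u∈ → x∈∁p⇒x∉p u∈ (x∈⁅x⁆ u))
            (PrimeIn-resp T ∈∁ (λ {z} z∈ → λ { refl → x∈∁p⇒x∉p z∈ (x∈⁅x⁆ u) })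
               (delete-leaf (Prime⇒PrimeIn-U T prime) pu ¬blocked))
        where
        ∈∁ : ∀ {z} → z ≢ u → z ∈ ∁ ⁅ u ⁆
        ∈∁ z≢u = x∉p⇒x∈∁p (z≢u ∘ x∈⁅y⁆⇒x≡y u)

        four : 4 ≤ ∣ ∁ ⁅ u ⁆ ∣
        four = subst (4 ≤_) (sym (trans (∣∁p∣≡n∸∣p∣ ⁅ u ⁆) (cong (n ∸_) (∣⁅x⁆∣≡1 u)))) (∸-monoˡ-≤ 1 5≤n)

      minimal⇒assertion₂ : Minimal T ⟦ x ⟧ → Assertion₂ T x
      minimal⇒assertion₂ min@(prime , _) u leaf with leaf⇒pendant T leaf
      ... | v , pu@(u~v , only) with ∈X? u | ∈X? v
      ...   | yes u∈X | _       = v , (leaf , u~v , only) , inj₁ u∈X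
      ...   | no _    | yes v∈X = v , (leaf , u~v , only) , inj₂ v∈X
      -- The leaf `u` is blocked, so deleting it together with `v` preserves primality and loses no
      -- prescribed vertex.
      ...   | no u∉X  | no v∉X with minimal⇒blocked min pu u∉X
      ...     | y , m , blocks =
        ⊥-elim (minimal⇒¬PrimeIn min (∁ (⁅ u ⁆ ∪ ⁅ v ⁆)) (blocks⇒four (PrimeIn⇒NoTwins primeIn) pu blocks)
          (λ z∈X → ∈∁pair⁺ ((λ { refl → u∉X z∈X }) , (λ { refl → v∉X z∈X })))
          (λ u∈S → proj₁ (∈∁pair⁻ u∈S) refl)
          (PrimeIn-resp T ∈∁pair⁺ ∈∁pair⁻ (delete-leaf-and-support primeIn pu blocks)))
        where
        primeIn = Prime⇒PrimeIn-U T prime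

      minimal⇒assertion₃ : Minimal T ⟦ x ⟧ → Assertion₃ T x
      minimal⇒assertion₃ min i _ y (leaf-y , xi~y , _) y∉X with leaf⇒pendant T leaf-y
      ... | v′ , py@(y~v′ , y-only) with y-only (x i) (~-sym xi~y)
      ...   | refl with minimal⇒blocked min py y∉X
      ...     | w , z , v~w , w≢y , v-only , pz@(z~w , _) , z≢v =
        degree≡2⁺ T xi~y v~w (≢-sym w≢y) v-only , opposite (∈X? z)
        where
        opposite : Dec (⟦ x ⟧ z) → _
        opposite (yes (j , refl)) = j , (λ { refl → z≢v refl }) , pendant⇒leaf T pz ,
          distance (v~w ◅ ~-sym z~w ◅ ε ,
                    (~⇒≢ T v~w ∷ ≢-sym z≢v ∷ []) ∷ (≢-sym (~⇒≢ T z~w) ∷ []) ∷ [] ∷ [])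
        -- A second leaf outside the prescribed set is blocked as well, so `w` too has degree two
        -- and the tree would be a path on four vertices.
        opposite (no z∉X) with minimal⇒blocked min pz z∉X
        ... | v″ , _ , _ , _ , w-only , _ with w-only (x i) (~-sym v~w)
        ...   | inj₁ v≡z  = ⊥-elim (z≢v (sym v≡z))
        ...   | inj₂ refl = ⊥-elim (¬blocks-both-ways py pz v-only w-only)

      -- When v is outside S and S meets two branches at v, each branch traces
      -- a module on S.
      leaves-outside : ∀ {S} → 4 ≤ ∣ S ∣ → PrimeIn T (_∈ S) → ∀ {v} → v ∉ S → ∃[ u ] Leaf T u × u ∉ S
      leaves-outside {S} 4≤S prime {v} v∉S
        with any? (λ u → (degree T u ≟ℕ 1) ×-dec ¬? (u ∈? S))
      ... | yes found = found
      ... | no none with fresh-U (v ∷ []) (≤-trans (s≤s (s≤s z≤n)) 5≤n)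
      ...   | w , w∉ with neighbour {v} {w} (λ v≡w → w∉ (here (sym v≡w)))
      ...   | a , v~a with nonleaf⇒other T (λ leaf → none (v , leaf , v∉S)) v~a
      ...   | b , v~b , b≢a with branch-leaf v~a | branch-leaf v~b
      ...   | p , leaf-p , a⇝p | q , leaf-q , b⇝q
        -- A third vertex `c` of `S` lies inside or outside the branch of `a`. With `p` or `q`
        -- respectively, it gives that side two elements, while the other leaf keeps the side from
        -- being all of `S`.
        with fresh S (p ∷ q ∷ []) (≤-trans (s≤s (s≤s (s≤s z≤n))) 4≤S)
      ...   | c , c∈S , c∉ = ⊥-elim (conclude (branch? v~a c))
        where
        Branch : Pred (Fin n) 0ℓ
        Branch = Star (Avoiding T v) a

        leaf∈S : ∀ {u} → Leaf T u → u ∈ S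
        leaf∈S {u} leaf = decidable-stable (u ∈? S) λ u∉S → none (u , leaf , u∉S)

        -- An edge within `S` cannot use `v`, so it never leaves a branch.
        closed : ∀ {s t} → Branch s → s ∈ S → t ∈ S → s ~ t → Branch t
        closed s∈B s∈S t∈S s~t = s∈B ◅◅ (s~t , (λ { refl → v∉S s∈S }) , (λ { refl → v∉S t∈S })) ◅ ε

        q∉B : ¬ Branch q
        q∉B a⇝q = b≢a (sym (branch-unique v~a v~b (a⇝q ◅◅ reverse (avoiding-sym T) b⇝q)))

        conclude : ¬ Dec (Branch c)
        conclude (yes c∈B) = q∉B (proj₂ (prime {λ t → t ∈ S × Branch t}
          (λ t → (t ∈? S) ×-dec branch? v~a t) proj₁
          (λ t∈S t∉ → inj₂ λ (m∈S , m∈B) t~m → t∉ (t∈S , closed m∈B m∈S t∈S (~-sym t~m)))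
          (leaf∈S leaf-p , a⇝p) (c∈S , c∈B) (λ { refl → c∉ (here refl) }) (leaf∈S leaf-q)))
        conclude (no c∉B) = proj₂ (prime {λ t → t ∈ S × ¬ Branch t}
          (λ t → (t ∈? S) ×-dec ¬? (branch? v~a t)) proj₁
          (λ t∈S t∉ → inj₂ λ (m∈S , m∉B) t~m →
            t∉ (t∈S , λ t∈B → m∉B (closed t∈B t∈S m∈S t~m)))
          (leaf∈S leaf-q , q∉B) (c∈S , c∉B) (λ { refl → c∉ (there (here refl)) }) (leaf∈S leaf-p)) a⇝p

      assertions⇒minimal : Assertion₁ T x → Assertion₂ T x → Assertion₃ T x → Minimal T ⟦ x ⟧
      assertions⇒minimal a₁ a₂ a₃ =
        PrimeIn-U⇒Prime T (≤-trans (n≤1+n 4) 5≤n) (NoTwins⇒PrimeIn noTwins) , minimal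
        where
        noTwins = assertion₁⇒NoTwins a₁

        minimal : ∀ S → (∀ v → ⟦ x ⟧ v → v ∈ S) → S ⊂ ⊤ → ¬ Prime (T [ S ])
        minimal S X⊆S (_ , o , _ , o∉S) prime@(4≤S , _)
          with leaves-outside 4≤S (Prime⇒PrimeIn-∈ T S prime) o∉S
        ... | u , leaf , u∉S with a₂ u leaf
        ...   | v , _ , inj₁ u∈X = u∉S (X⊆S u u∈X)
        -- Here the support vertex `v` is prescribed, and the absence of twins makes `u` its only
        -- leaf neighbour. As `u` is not prescribed, assertion 3 applies and yields the leaf `x j`
        -- at distance two.
        ...   | v , plus@(_ , u~v , u-only) , inj₂ (i , refl)
          with a₃ i (u , plus) u (leaf , ~-sym u~v , only-leaf) (u∉S ∘ X⊆S u)
          where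
          only-leaf : ∀ z → Leaf T z → v ~ z → z ≡ u
          only-leaf z leaf-z v~z with leaf⇒pendant T leaf-z
          ... | v′ , pz with proj₂ pz v (~-sym v~z)
          ...   | refl = noTwins pz (u~v , u-only)
        ...   | deg , j , _ , leaf-xj , dist with distance-two⇒midpoint T dist | leaf⇒pendant T leaf-xj
        ...   | v≢z , _ , v~w , w~z | w′ , _ , z-only with z-only _ (~-sym w~z)
        -- A third vertex of `S` shows that the module formed by `v` and `x j` is not all of `S`.
        ...   | refl with fresh S (v ∷ x j ∷ []) (≤-trans (s≤s (s≤s (s≤s z≤n))) 4≤S)
        ...   | c , c∈S , c∉ = conclude
          (Prime⇒PrimeIn-∈ T S prime {λ t → t ≡ v ⊎ t ≡ x j} (λ t → (t ≟ v) ⊎-dec (t ≟ x j))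
            (λ { (inj₁ refl) → X⊆S _ (i , refl) ; (inj₂ refl) → X⊆S _ (j , refl) })
            mod (inj₁ refl) (inj₂ refl) v≢z c∈S)
          where
          w≢u : w′ ≢ u
          w≢u refl = v≢z (sym (u-only _ w~z))

          mod : ModuleIn T (_∈ S) (λ t → t ≡ v ⊎ t ≡ x j)
          mod {t} t∈S t∉ with t ≟ w′
          ... | yes refl = inj₁ λ { (inj₁ refl) → ~-sym v~w ; (inj₂ refl) → w~z }
          -- Of the two neighbours of `v`, `u` is missing from `S`; within `S`, `v` is thus attached
          -- to `w′` alone, just as `x j` is.
          ... | no t≢w   = inj₂ λ { (inj₁ refl) t~v → at-v (degree≡2⁻ T deg v~w (~-sym u~v) w≢u t (~-sym t~v))
                                  ; (inj₂ refl) t~z → t≢w (z-only t (~-sym t~z)) }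
            where
            at-v : ¬ (t ≡ w′ ⊎ t ≡ u)
            at-v (inj₁ t≡w)  = t≢w t≡w
            at-v (inj₂ refl) = u∉S t∈S

          conclude : ¬ (c ≡ v ⊎ c ≡ x j)
          conclude (inj₁ c≡v) = c∉ (here c≡v)
          conclude (inj₂ c≡z) = c∉ (there (here c≡z))

theorem1p2 : ∀ {n k : ℕ} (T : Graph n) → Tree T → 5 ≤ n →
    (x : Fin k → Fin n) → Injective _≡_ _≡_ x → 1 ≤ k →
    Minimal T ⟦ x ⟧ ⇔ (Assertion₁ T x × Assertion₂ T x × Assertion₃ T x)
theorem1p2 T tree 5≤n x _ _ = mk⇔
  (λ min → PrimeIn⇒assertion₁ T tree 5≤n x (Prime⇒PrimeIn-U T (proj₁ min)) ,
           minimal⇒assertion₂ T tree 5≤n x min ,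
           minimal⇒assertion₃ T tree 5≤n x min)
  (λ (a₁ , a₂ , a₃) → assertions⇒minimal T tree 5≤n x a₁ a₂ a₃)
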